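{- Let $\mathcal{C}$ be a Fraïssé class of finite structures over a finite relational language, and let $M$ be its Fraïssé limit. Assume that every structure in $\mathcal{C}$ is rigid (has trivial automorphism group). Then at least one of the following holds: (a) $M$ has a reduct which is a total order, i.e. there is a strict total order on the domain of $M$ that is definable in $M$ by a first-order formula without parameters; (b) there are structures $A,B\in\mathcal{C}$ with $|A|=2$ which witness that $\mathcal{C}$ is not a Ramsey class, i.e. for every $C\in\mathcal{C}$ there is a colouring of the embeddings $A\to C$ with two colours such that no embedding $g:B\to C$ is monochromatic.
   Context: All structures are non-empty, and classes are closed under isomorphism and hereditary (closed under induced substructures). A Fraïssé class is such a class satisfying the joint embedding property (any two members embed in a common member) and the amalgamation property (for $A,B_1,B_2\in\mathcal{C}$ and embeddings $f_i:A\to B_i$ there exist $C\in\mathcal{C}$ and embeddings $g_i:B_i\to C$ with $g_1\circ f_1=g_2\circ f_2$). Its Fraïssé limit is the unique countable homogeneous structure whose age (class of finite structures embeddable in it) is $\mathcal{C}$; homogeneous means every isomorphism between finite substructures extends to an automorphism. An embedding $g:B\to C$ is monochromatic for a colouring of the embeddings $A\to C$ if all embeddings $A\to C$ whose image is contained in the image of $g$ receive the same colour. $\mathcal{C}$ is a Ramsey class if for all $A,B\in\mathcal{C}$ there is $C\in\mathcal{C}$ such that every $2$-colouring of the embeddings $A\to C$ admits a monochromatic embedding $B\to C$. -}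

module Defs where

open import Data.Bool.Base using (Bool)
open import Data.Empty using (⊥)
open import Data.Fin.Base using (Fin)
open import Data.Nat.Base using (ℕ; suc)
open import Data.Product.Base using (Σ-syntax; ∃-syntax; _×_; _,_)
open import Data.Irrelevant using ([_])
open import Data.Refinement.Base using (Refinement; value; _,_)
open import Data.Sum.Base using (_⊎_)
open import Data.Vec.Base using (Vec; []; _∷_; lookup; map)
open import Function.Bundles using (_⇔_; _↔_; _↣_)
open import Function.Definitions using (Injective; StrictlySurjective)
open import Level using (Level; 0ℓ; _⊔_) renaming (suc to lsuc)
open import Relation.Binary.Core using (Rel)
open import Relation.Binary.PropositionalEquality.Core using (_≡_; _≗_)
open import Relation.Binary.Structures using (IsStrictTotalOrder)
open import Relation.Nullary.Negation.Core using (¬_)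
open import Relation.Unary using (Pred; Satisfiable)

private
  variable
    ℓ : Level

record Language : Set where
  field
    #symbols : ℕ
    arity    : Fin #symbols → ℕ

  Symbol : Set
  Symbol = Fin #symbols

open Language public

-- All structures are non-empty.  The point is not part of the signature:
-- embeddings and isomorphisms ignore it.
record Structure (L : Language) : Set₁ where
  field
    Carrier   : Set
    rel       : (R : Symbol L) → Vec Carrier (arity L R) → Set
    inhabited : Carrier

open Structure public

module _ {L : Language} where

  HasSize : Structure L → ℕ → Set
  HasSize A n = Carrier A ↔ Fin n

  Finite : Structure L → Set
  Finite A = ∃[ n ] HasSize A n

  -- Finite or countably infinite.
  Countable : Structure L → Set
  Countable A = Carrier A ↣ ℕ

  record Embedding (A B : Structure L) : Set where
    field
      to        : Carrier A → Carrier B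
      injective : Injective _≡_ _≡_ to
      rel-⇔     : ∀ R (xs : Vec (Carrier A) (arity L R)) →
                  rel A R xs ⇔ rel B R (map to xs)

  open Embedding public

  record Isomorphism (A B : Structure L) : Set where
    field
      embedding  : Embedding A B
      surjective : StrictlySurjective _≡_ (to embedding)

    apply : Carrier A → Carrier B
    apply = to embedding

  open Isomorphism public

  Automorphism : Structure L → Set
  Automorphism A = Isomorphism A A

  Rigid : Structure L → Set
  Rigid A = (α : Automorphism A) → ∀ x → apply α x ≡ x

  -- The substructure of M induced on a non-empty subset P.  Refinement makes
  -- membership proofs irrelevant, so elements are equal iff their values are.
  Induced : (M : Structure L) (P : Pred (Carrier M) 0ℓ) → Satisfiable P →
            Structure L
  Induced M P (x , Px) = record
    { Carrier   = Refinement (Carrier M) P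
    ; rel       = λ R xs → rel M R (map value xs)
    ; inhabited = x , [ Px ]
    }

  Homogeneous : Structure L → Set₁
  Homogeneous M =
    (P Q : Pred (Carrier M) 0ℓ) (p : Satisfiable P) (q : Satisfiable Q) →
    Finite (Induced M P p) → Finite (Induced M Q q) →
    (φ : Isomorphism (Induced M P p) (Induced M Q q)) →
    Σ[ α ∈ Automorphism M ]
      (∀ (x : Refinement (Carrier M) P) → apply α (value x) ≡ value (apply φ x))

  Class : (ℓ : Level) → Set (lsuc 0ℓ ⊔ lsuc ℓ)
  Class ℓ = Pred (Structure L) ℓ

  IsoClosed : Class ℓ → Set (lsuc 0ℓ ⊔ ℓ)
  IsoClosed 𝒞 = ∀ {A B} → Isomorphism A B → 𝒞 A → 𝒞 B

  Hereditary : Class ℓ → Set (lsuc 0ℓ ⊔ ℓ)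
  Hereditary 𝒞 = ∀ {B} (P : Pred (Carrier B) 0ℓ) (p : Satisfiable P) →
                 𝒞 B → 𝒞 (Induced B P p)

  JointEmbedding : Class ℓ → Set (lsuc 0ℓ ⊔ ℓ)
  JointEmbedding 𝒞 = ∀ {A B} → 𝒞 A → 𝒞 B →
    ∃[ C ] (𝒞 C × Embedding A C × Embedding B C)

  Amalgamation : Class ℓ → Set (lsuc 0ℓ ⊔ ℓ)
  Amalgamation 𝒞 = ∀ {A B₁ B₂} → 𝒞 A → 𝒞 B₁ → 𝒞 B₂ →
    (f₁ : Embedding A B₁) (f₂ : Embedding A B₂) →
    ∃[ C ] (𝒞 C × Σ[ g₁ ∈ Embedding B₁ C ] Σ[ g₂ ∈ Embedding B₂ C ]
      (∀ x → to g₁ (to f₁ x) ≡ to g₂ (to f₂ x)))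

  record IsFraïsséClass (𝒞 : Class ℓ) : Set (lsuc 0ℓ ⊔ ℓ) where
    field
      finite         : ∀ {A} → 𝒞 A → Finite A
      isoClosed      : IsoClosed 𝒞
      hereditary     : Hereditary 𝒞
      jointEmbedding : JointEmbedding 𝒞
      amalgamation   : Amalgamation 𝒞

  Age : Structure L → Class 0ℓ
  Age M A = Finite A × Embedding A M

  record IsFraïsséLimit (𝒞 : Class ℓ) (M : Structure L) : Set (lsuc 0ℓ ⊔ ℓ) where
    field
      countable   : Countable M
      homogeneous : Homogeneous M
      age         : ∀ A → 𝒞 A ⇔ Age M A

  -- Embeddings carry proofs, so a colouring has to agree on embeddings that
  -- are the same map.
  record Colouring (A C : Structure L) : Set where
    field
      colour      : Embedding A C → Bool
      colour-cong : ∀ {e e′} → to e ≗ to e′ → colour e ≡ colour e′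

  open Colouring public

  ImageContained : {A B C : Structure L} → Embedding A C → Embedding B C → Set
  ImageContained e g = ∀ a → ∃[ b ] to g b ≡ to e a

  Monochromatic : {A B C : Structure L} → Colouring A C → Embedding B C → Set
  Monochromatic χ g = ∀ e e′ → ImageContained e g → ImageContained e′ g →
                      colour χ e ≡ colour χ e′

  WitnessNotRamsey : Class ℓ → (A B : Structure L) → Set (lsuc 0ℓ ⊔ ℓ)
  WitnessNotRamsey 𝒞 A B = ∀ {C} → 𝒞 C →
    Σ[ χ ∈ Colouring A C ] (∀ (g : Embedding B C) → ¬ Monochromatic χ g)

-- First-order formulas with equality, free variables in Fin n; quantifiers
-- bind variable zero.
data Formula (L : Language) (n : ℕ) : Set where
  atom          : (R : Symbol L) → Vec (Fin n) (arity L R) → Formula L n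
  _≐_           : Fin n → Fin n → Formula L n
  ⊥′            : Formula L n
  _∧′_ _∨′_ _⇒′_ : Formula L n → Formula L n → Formula L n
  ∀′ ∃′         : Formula L (suc n) → Formula L n

module _ {L : Language} where

  infix 4 _⊨_[_]

  _⊨_[_] : (M : Structure L) {n : ℕ} → Formula L n → Vec (Carrier M) n → Set
  M ⊨ atom R is [ ρ ] = rel M R (map (lookup ρ) is)
  M ⊨ i ≐ j     [ ρ ] = lookup ρ i ≡ lookup ρ j
  M ⊨ ⊥′        [ ρ ] = ⊥
  M ⊨ φ ∧′ ψ    [ ρ ] = (M ⊨ φ [ ρ ]) × (M ⊨ ψ [ ρ ])
  M ⊨ φ ∨′ ψ    [ ρ ] = (M ⊨ φ [ ρ ]) ⊎ (M ⊨ ψ [ ρ ])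
  M ⊨ φ ⇒′ ψ    [ ρ ] = M ⊨ φ [ ρ ] → M ⊨ ψ [ ρ ]
  M ⊨ ∀′ φ      [ ρ ] = (x : Carrier M) → M ⊨ φ [ x ∷ ρ ]
  M ⊨ ∃′ φ      [ ρ ] = Σ[ x ∈ Carrier M ] (M ⊨ φ [ x ∷ ρ ])

  Definable₂ : (M : Structure L) → Rel (Carrier M) 0ℓ → Set
  Definable₂ M _∼_ = Σ[ φ ∈ Formula L 2 ]
    (∀ x y → (x ∼ y) ⇔ (M ⊨ φ [ x ∷ y ∷ [] ]))

  HasTotalOrderReduct : Structure L → Set₁
  HasTotalOrderReduct M = Σ[ _<_ ∈ Rel (Carrier M) 0ℓ ]
    (IsStrictTotalOrder _≡_ _<_ × Definable₂ M _<_)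

{-# OPTIONS --safe #-}

-- Suppose (b) fails, so that the Ramsey property holds for all A, B with |A| = 2.
-- Fix an arbitrary linear order on M, colour pairs by whether it agrees with
-- their enumeration, and apply the Ramsey property once for each of the finitely
-- many quantifier-free types t of pairs.  This embeds every B in 𝒞 into M such
-- that the order of two points of the image depends only on their type, i.e. some
-- set S of types defines a linear order on B.  If no S defined a linear order on
-- M, then taking for B a finite subset of M on which every one of the finitely
-- many S fails would give a contradiction.

module Submission where

open import Defs
open import Axiom.ExcludedMiddle using (ExcludedMiddle)
open import Data.Bool.Base using (Bool; true; false; if_then_else_)
open import Data.Empty using (⊥-elim)
open import Data.Fin.Base using (Fin; zero; suc)
open import Data.List.Base as List using (List; []; _∷_; concatMap; allFin; cartesianProductWith; deduplicate)
open import Data.List.Membership.Propositional using (_∈_; lose)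
open import Data.List.Membership.Propositional.Properties using (∈-concatMap⁺; ∈-cartesianProductWith⁺; ∈-allFin; ∈-deduplicate⁺; ∈-map⁺; ∈-lookup)
open import Data.List.Relation.Unary.All as All using ([]; _∷_)
open import Data.List.Relation.Unary.AllPairs using ([]; _∷_)
open import Data.List.Relation.Unary.Any using (here; there; index)
open import Data.List.Relation.Unary.Any.Properties using (lookup-index)
open import Data.List.Relation.Unary.Unique.DecPropositional.Properties using (deduplicate-!)
open import Data.List.Relation.Unary.Unique.Propositional using (Unique)
open import Data.Nat.Base using (ℕ; zero; suc; _<_)
open import Data.Nat.Properties using (_<?_; <-trans; <-irrefl; <-cmp)
open import Data.Product.Base using (Σ-syntax; ∃-syntax; _×_; _,_; proj₁; proj₂)
open import Data.Sum.Base using (_⊎_; inj₁; inj₂)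
open import Data.Vec.Base using (Vec; []; _∷_; lookup; map; fromList; head; tail)
open import Data.Vec.Membership.Propositional using () renaming (_∈_ to _∈ᵥ_)
open import Data.Vec.Membership.Propositional.Properties using (∈-fromList⁺)
open import Data.Vec.Properties using (map-∘; map-cong; lookup-map)
open import Data.Vec.Relation.Unary.Any using (here; there)
open import Function.Base using (_∘_; _on_; _$_)
open import Function.Bundles using (_⇔_; mk⇔; Equivalence; Injection)
open import Function.Construct.Composition using (_⇔-∘_)
open import Function.Construct.Identity using (↔-id; ⇔-id)
open import Function.Definitions using (Injective)
open import Level using (Level; Lift; lift; lower; 0ℓ; _⊔_) renaming (suc to lsuc)
open import Relation.Binary.Core using (Rel)
open import Relation.Binary.Definitions using (Tri; tri<; tri≈; tri>)
open import Relation.Binary.PropositionalEquality.Core using (_≡_; _≢_; refl; sym; trans; cong; cong₂; subst)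
open import Relation.Binary.PropositionalEquality.Properties using (isEquivalence)
open import Relation.Binary.Structures using (IsStrictTotalOrder)
open import Relation.Binary.Structures.Biased using (isStrictTotalOrderᶜ)
open import Relation.Nullary.Decidable using (Dec; does; yes; no; map′; does-⇔; dec-true; decidable-stable)
open import Relation.Nullary.Negation using (¬_; contradiction)

private
  variable
    X Y : Set
    k n : ℕ

-- Vectors, decidability and finite enumerations.

lookup-injective : {xs : List X} → Unique xs → Injective _≡_ _≡_ (List.lookup xs)
lookup-injective {xs = _ ∷ _} _ {zero} {zero} _ = refl
lookup-injective {xs = _ ∷ _} (x∉ ∷ _) {zero} {suc j} eq =
  contradiction eq (All.lookup x∉ (∈-lookup j))
lookup-injective {xs = _ ∷ _} (x∉ ∷ _) {suc i} {zero} eq =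
  contradiction (sym eq) (All.lookup x∉ (∈-lookup i))
lookup-injective {xs = _ ∷ _} (_ ∷ u) {suc i} {suc j} eq =
  cong suc (lookup-injective u eq)

lookup-pair-injective : {x y : X} → x ≢ y → Injective _≡_ _≡_ (lookup (x ∷ y ∷ []))
lookup-pair-injective x≢y {zero}     {zero}     _  = refl
lookup-pair-injective x≢y {zero}     {suc zero} eq = contradiction eq x≢y
lookup-pair-injective x≢y {suc zero} {zero}     eq = contradiction (sym eq) x≢y
lookup-pair-injective x≢y {suc zero} {suc zero} _  = refl

map-≡⇒≗ : {f g : X → Y} {xs : Vec X n} → map f xs ≡ map g xs →
          ∀ {x} → x ∈ᵥ xs → f x ≡ g x
map-≡⇒≗ eq (here refl) = cong head eq
map-≡⇒≗ eq (there x∈)  = map-≡⇒≗ (cong tail eq) x∈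

does-≡⇒⇔ : (a? : Dec X) (b? : Dec Y) → does a? ≡ does b? → X ⇔ Y
does-≡⇒⇔ (yes x) (yes y) _ = mk⇔ (λ _ → y) (λ _ → x)
does-≡⇒⇔ (no ¬x) (no ¬y) _ = mk⇔ (⊥-elim ∘ ¬x) (⊥-elim ∘ ¬y)

does-true : (a? : Dec X) → does a? ≡ true → X
does-true (yes x) _ = x

subst₃ : (P : X → X → X → Set) {x x′ y y′ z z′ : X} →
         x ≡ x′ → y ≡ y′ → z ≡ z′ → P x y z → P x′ y′ z′
subst₃ P refl refl refl p = p

vectors : List X → (n : ℕ) → List (Vec X n)
vectors xs zero    = [] ∷ []
vectors xs (suc n) = cartesianProductWith _∷_ xs (vectors xs n)

∈-vectors : {xs : List X} → (∀ x → x ∈ xs) → (v : Vec X n) → v ∈ vectors xs n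
∈-vectors all []      = here refl
∈-vectors all (x ∷ v) = ∈-cartesianProductWith⁺ _∷_ (all x) (∈-vectors all v)

booleans : List Bool
booleans = true ∷ false ∷ []

∈-booleans : ∀ b → b ∈ booleans
∈-booleans true  = here refl
∈-booleans false = there (here refl)

-- Repetitions are excluded because `Fin size` is to be the carrier of a finite substructure
-- embedded by `points`.
record FiniteCover (ws : List X) : Set where
  field
    size     : ℕ
    points   : Fin size → X
    distinct : Injective _≡_ _≡_ points
    covers   : ∀ {w} → w ∈ ws → ∃[ i ] points i ≡ w

finiteCover : ExcludedMiddle 0ℓ → (ws : List X) → FiniteCover ws
finiteCover em ws = record
  { size     = List.length (deduplicate _≟_ ws)
  ; points   = List.lookup (deduplicate _≟_ ws)
  ; distinct = lookup-injective (deduplicate-! _≟_ ws)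
  ; covers   = λ w∈ → let w∈′ = ∈-deduplicate⁺ _≟_ w∈ in
                      index w∈′ , sym (lookup-index w∈′)
  }
  where
  _≟_ : (x y : _) → Dec (x ≡ y)
  x ≟ y = em

-- Boolean functions of n variables, represented so that they can be
-- enumerated without function extensionality.
data Tree : ℕ → Set where
  leaf : Bool → Tree zero
  node : Tree n → Tree n → Tree (suc n)

eval : Tree n → Vec Bool n → Bool
eval (leaf b)   []          = b
eval (node l r) (true  ∷ v) = eval l v
eval (node l r) (false ∷ v) = eval r v

tabulate : (Vec Bool n → Bool) → Tree n
tabulate {zero}  f = leaf (f [])
tabulate {suc _} f = node (tabulate (f ∘ (true ∷_))) (tabulate (f ∘ (false ∷_)))

eval-tabulate : (f : Vec Bool n → Bool) (v : Vec Bool n) → eval (tabulate f) v ≡ f v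
eval-tabulate f []          = refl
eval-tabulate f (true  ∷ v) = eval-tabulate (f ∘ (true ∷_)) v
eval-tabulate f (false ∷ v) = eval-tabulate (f ∘ (false ∷_)) v

trees : (n : ℕ) → List (Tree n)
trees zero    = List.map leaf booleans
trees (suc n) = cartesianProductWith node (trees n) (trees n)

∈-trees : (S : Tree n) → S ∈ trees n
∈-trees (leaf b)   = ∈-map⁺ leaf (∈-booleans b)
∈-trees (node l r) = ∈-cartesianProductWith⁺ node (∈-trees l) (∈-trees r)

-- The order axioms are localised at three points, so that each failure is witnessed by a finite
-- set.
TotalAt : Rel X 0ℓ → X → X → X → Set
TotalAt _∼_ x y z = (x ∼ y → y ∼ z → x ∼ z) × Tri (x ∼ y) (x ≡ y) (y ∼ x)

totalAt⇒isStrictTotalOrder : {_∼_ : Rel X 0ℓ} → (∀ x y z → TotalAt _∼_ x y z) →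
                             IsStrictTotalOrder _≡_ _∼_
totalAt⇒isStrictTotalOrder total = isStrictTotalOrderᶜ record
  { isEquivalence = isEquivalence
  ; trans         = λ {x} {y} {z} → proj₁ (total x y z)
  ; compare       = λ x y → proj₂ (total x y x)
  }

<-on-totalAt : {f : X → ℕ} → Injective _≡_ _≡_ f → ∀ x y z → TotalAt (_<_ on f) x y z
<-on-totalAt {f = f} inj x y z = <-trans , compare
  where
  compare : Tri (f x < f y) (x ≡ y) (f y < f x)
  compare with <-cmp (f x) (f y)
  ... | tri< a ¬b ¬c = tri< a (¬b ∘ cong f) ¬c
  ... | tri≈ ¬a b ¬c = tri≈ ¬a (inj b) ¬c
  ... | tri> ¬a ¬b c = tri> ¬a (¬b ∘ cong f) c

totalAt-map : {_∼_ : Rel X 0ℓ} {_≈_ : Rel Y 0ℓ} {f : X → Y} → Injective _≡_ _≡_ f →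
              (∀ x y → (x ∼ y) ⇔ (f x ≈ f y)) →
              ∀ {x y z} → TotalAt _∼_ x y z → TotalAt _≈_ (f x) (f y) (f z)
totalAt-map {X} {_∼_ = _∼_} {_≈_} {f} inj ⇔-rel {x} {y} {z} (tr , cmp) =
  (λ p q → push (tr (pull p) (pull q))) , compare cmp
  where
  push : ∀ {a b} → a ∼ b → f a ≈ f b
  push = Equivalence.to (⇔-rel _ _)
  pull : ∀ {a b} → f a ≈ f b → a ∼ b
  pull = Equivalence.from (⇔-rel _ _)
  compare : Tri (x ∼ y) (x ≡ y) (y ∼ x) → Tri (f x ≈ f y) (f x ≡ f y) (f y ≈ f x)
  compare (tri< a ¬b ¬c) = tri< (push a) (¬b ∘ inj) (¬c ∘ pull)
  compare (tri≈ ¬a b ¬c) = tri≈ (¬a ∘ pull) (cong f b) (¬c ∘ pull)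
  compare (tri> ¬a ¬b c) = tri> (¬a ∘ pull) (¬b ∘ inj) (push c)

-- Structures on listed points, and formulas for sets of types of pairs.

module _ {L : Language} where

  _∘ₑ_ : {A B C : Structure L} → Embedding B C → Embedding A B → Embedding A C
  _∘ₑ_ {C = C} g f = record
    { to        = to g ∘ to f
    ; injective = injective f ∘ injective g
    ; rel-⇔     = λ R xs →
        subst (λ ys → _ ⇔ rel C R ys) (sym (map-∘ (to g) (to f) xs))
          (rel-⇔ g R (map (to f) xs) ⇔-∘ rel-⇔ f R xs)
    }

  -- With the carrier given outright, a substructure on `n` listed points has carrier `Fin n`, and
  -- the identity proves it finite.
  Pullback : (A : Structure L) → (X → Carrier A) → X → Structure L
  Pullback {X} A f x = record
    { Carrier   = X
    ; rel       = λ R xs → rel A R (map f xs)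
    ; inhabited = x
    }

  pullback-embedding : {A : Structure L} {f : X → Carrier A} {x : X} →
                       Injective _≡_ _≡_ f → Embedding (Pullback A f x) A
  pullback-embedding {f = f} inj = record
    { to = f ; injective = inj ; rel-⇔ = λ _ _ → mk⇔ (λ r → r) (λ r → r) }

  Pair : (A : Structure L) → Carrier A → Carrier A → Structure L
  Pair A x y = Pullback A (lookup (x ∷ y ∷ [])) zero

  -- The positive form of the failure of `WitnessNotRamsey`: one `C` that serves all colourings.
  RamseyFor : {ℓ : Level} → Class {L} ℓ → (A B : Structure L) → Set (lsuc 0ℓ ⊔ ℓ)
  RamseyFor 𝒞 A B = ∃[ C ] (𝒞 C × (∀ (χ : Colouring A C) →
    Σ[ g ∈ Embedding B C ] Monochromatic χ g))

  Atom : ℕ → Set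
  Atom n = Σ[ R ∈ Symbol L ] Vec (Fin n) (arity L R)

  formula : Atom n → Formula L n
  formula (R , is) = atom R is

  -- The tree is a Boolean function of the truth values of the atoms, that is, a set of types; the
  -- formula is its disjunctive expansion. `⊥′ ⇒′ ⊥′` stands for truth, and implication of `⊥′` for
  -- negation.
  decide : Vec (Atom n) k → Tree k → Formula L n
  decide []       (leaf b)   = if b then ⊥′ ⇒′ ⊥′ else ⊥′
  decide (α ∷ αs) (node l r) =
    (formula α ∧′ decide αs l) ∨′ ((formula α ⇒′ ⊥′) ∧′ decide αs r)

  atomList : (n : ℕ) → List (Atom n)
  atomList n = concatMap (λ R → List.map (R ,_) (vectors (allFin n) (arity L R)))
                         (allFin (#symbols L))

  ∈-atomList : (α : Atom n) → α ∈ atomList n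
  ∈-atomList (R , is) = ∈-concatMap⁺ _ $
    lose (∈-allFin R) (∈-map⁺ (R ,_) (∈-vectors ∈-allFin is))

  #atoms : ℕ
  #atoms = List.length (atomList 2)

  atoms : Vec (Atom 2) #atoms
  atoms = fromList (atomList 2)

  -- The conjunct x ≢ y is needed because (x , x) may satisfy the same relations
  -- as a pair of distinct points.
  orderFormula : Tree #atoms → Formula L 2
  orderFormula S = ((zero ≐ suc zero) ⇒′ ⊥′) ∧′ decide atoms S

  _⊢_<[_]_ : (A : Structure L) → Carrier A → Tree #atoms → Carrier A → Set
  A ⊢ x <[ S ] y = A ⊨ orderFormula S [ x ∷ y ∷ [] ]

  -- Types of pairs and their behaviour under embeddings.

  module _ (em : ExcludedMiddle 0ℓ) where

    truth : (A : Structure L) → Vec (Carrier A) n → Atom n → Bool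
    truth A ρ α = does (em {A ⊨ formula α [ ρ ]})

    decide-correct : (A : Structure L) (ρ : Vec (Carrier A) n)
                     (αs : Vec (Atom n) k) (S : Tree k) →
                     (eval S (map (truth A ρ) αs) ≡ true) ⇔ (A ⊨ decide αs S [ ρ ])
    decide-correct A ρ [] (leaf true)  = mk⇔ (λ _ ()) (λ _ → refl)
    decide-correct A ρ [] (leaf false) = mk⇔ (λ ()) (λ ())
    decide-correct A ρ (α ∷ αs) (node l r) with em {A ⊨ formula α [ ρ ]}
    ... | yes p = mk⇔ (λ e → inj₁ (p , Equivalence.to (decide-correct A ρ αs l) e))
      λ { (inj₁ (_ , q))  → Equivalence.from (decide-correct A ρ αs l) q
        ; (inj₂ (¬p , _)) → contradiction p ¬p }
    ... | no ¬p = mk⇔ (λ e → inj₂ (¬p , Equivalence.to (decide-correct A ρ αs r) e))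
      λ { (inj₁ (p , _)) → contradiction p ¬p
        ; (inj₂ (_ , q)) → Equivalence.from (decide-correct A ρ αs r) q }

    truth-embedding : {A C : Structure L} (e : Embedding A C)
                      (ρ : Vec (Carrier A) n) (α : Atom n) →
                      truth A ρ α ≡ truth C (map (to e) ρ) α
    truth-embedding {A = A} {C} e ρ (R , is) = does-⇔
      (subst (λ xs → _ ⇔ rel C R xs)
        (trans (sym (map-∘ (to e) (lookup ρ) is))
               (map-cong (λ i → sym (lookup-map i (to e) ρ)) is))
        (rel-⇔ e R (map (lookup ρ) is)))
      em em

    -- The quantifier-free type of the ordered pair, apart from equality. Atoms may repeat a
    -- variable, so it also records the relations on each point alone.
    pairType : (A : Structure L) → Carrier A → Carrier A → Vec Bool #atoms
    pairType A x y = map (truth A (x ∷ y ∷ [])) atoms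

    pairType-embedding : {A C : Structure L} (e : Embedding A C) → ∀ x y →
                         pairType A x y ≡ pairType C (to e x) (to e y)
    pairType-embedding e x y = map-cong (truth-embedding e (x ∷ y ∷ [])) atoms

    -- `atoms` lists every relational atom in two variables, so equal types mean that all relations
    -- are preserved and reflected.
    pair-embedding : {A C : Structure L} {x y : Carrier A} {u v : Carrier C} →
                     pairType A x y ≡ pairType C u v → u ≢ v →
                     Embedding (Pair A x y) C
    pair-embedding {u = u} {v} eq u≢v = record
      { to        = lookup (u ∷ v ∷ [])
      ; injective = lookup-pair-injective u≢v
      ; rel-⇔     = λ R is → does-≡⇒⇔ em em
          (map-≡⇒≗ eq (∈-fromList⁺ (∈-atomList (R , is))))
      }

    -- From the Ramsey property for pairs to a definable order.

    module _ {ℓ : Level} {𝒞 : Class {L} ℓ} {M : Structure L}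
             (age : ∀ A → 𝒞 A ⇔ Age M A) where

      substructure∈ : (f : Fin n → Carrier M) {i : Fin n} → Injective _≡_ _≡_ f →
                      𝒞 (Pullback M f i)
      substructure∈ f inj =
        Equivalence.from (age _) ((_ , ↔-id _) , pullback-embedding inj)

      module _ (ν : Carrier M → ℕ)
               (ramsey : ∀ {A B} → 𝒞 A → 𝒞 B → HasSize A 2 → RamseyFor 𝒞 A B) where

        -- Exchanging the two pairs gives the converse implication, so pairs of distinct points of
        -- type `t` are all increasing or all not.
        Uniform : {B : Structure L} → Embedding B M → Vec Bool #atoms → Set
        Uniform {B} f t = ∀ {b b′ c c′} → b ≢ b′ → c ≢ c′ →
          pairType B b b′ ≡ t → pairType B c c′ ≡ t →
          ν (to f b) < ν (to f b′) → ν (to f c) < ν (to f c′)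

        -- Passing to a smaller copy keeps what has been achieved, so the types can be treated one
        -- after another.
        uniform-∘ : {B C : Structure L} {f : Embedding C M} (g : Embedding B C) →
                    ∀ {t} → Uniform f t → Uniform (f ∘ₑ g) t
        uniform-∘ g u b≢b′ c≢c′ eb ec =
          u (b≢b′ ∘ injective g) (c≢c′ ∘ injective g)
            (trans (sym (pairType-embedding g _ _)) eb)
            (trans (sym (pairType-embedding g _ _)) ec)

        order-colouring : {A C : Structure L} → Embedding C M →
                          (x y : Carrier A) → Colouring A C
        order-colouring f x y = record
          { colour      = λ e → does (ν (to f (to e x)) <? ν (to f (to e y)))
          ; colour-cong = λ e≗e′ → cong₂ (λ u v → does (ν (to f u) <? ν (to f v)))
                                         (e≗e′ x) (e≗e′ y)
          }

        -- Induction on the types, for all `B` at once. A Ramsey structure `C` for `B` and the type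
        -- `t` is chosen first and embedded by `f` uniformly for the remaining types. Only then are
        -- pairs in `C` coloured, by the order of their images under `f`.
        uniform-embedding : (ts : List (Vec Bool #atoms)) {B : Structure L} → 𝒞 B →
                            Σ[ f ∈ Embedding B M ] (∀ {t} → t ∈ ts → Uniform f t)
        uniform-embedding [] {B} B∈ =
          proj₂ (Equivalence.to (age B) B∈) , λ ()
        uniform-embedding (t ∷ ts) {B} B∈
          with em {∃[ x ] ∃[ y ] (x ≢ y × pairType M x y ≡ t)}
        -- No distinct points of `M` have type `t`, hence none of `B` do, and uniformity at `t` is
        -- vacuous.
        ... | no ¬realised = f , λ where
            (here refl) b≢b′ _ eb _ → contradiction
              (_ , _ , b≢b′ ∘ injective f , trans (sym (pairType-embedding f _ _)) eb)
              ¬realised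
            (there t∈)  → uniform t∈
          where
          IH      = uniform-embedding ts B∈
          f       = proj₁ IH
          uniform = proj₂ IH
        ... | yes (x , y , x≢y , refl) = f ∘ₑ g , λ where
            (here refl) → at-t
            (there t∈)  → uniform-∘ {f = f} g (uniform t∈)
          where
          R = ramsey (substructure∈ (lookup (x ∷ y ∷ [])) {zero}
                                    (lookup-pair-injective x≢y)) B∈ (↔-id _)
          C = proj₁ R
          IH = uniform-embedding ts (proj₁ (proj₂ R))
          f       = proj₁ IH
          uniform = proj₂ IH
          χ = order-colouring f zero (suc zero)
          g = proj₁ (proj₂ (proj₂ R) χ)
          mono = proj₂ (proj₂ (proj₂ R) χ)

          pair : ∀ {b b′} → b ≢ b′ → pairType B b b′ ≡ pairType M x y →
                 Embedding (Pair M x y) C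
          pair b≢b′ eb = pair-embedding {A = M} {C} {x} {y}
            (trans (sym eb) (pairType-embedding g _ _)) (b≢b′ ∘ injective g)

          pair⊆g : ∀ {b b′} (b≢b′ : b ≢ b′) eb → ImageContained (pair b≢b′ eb) g
          pair⊆g b≢b′ eb zero       = _ , refl
          pair⊆g b≢b′ eb (suc zero) = _ , refl

          -- Both pairs give embeddings into the image of `g`, and their colours are the truth
          -- values of the two comparisons.
          at-t : Uniform (f ∘ₑ g) (pairType M x y)
          at-t b≢b′ c≢c′ eb ec b<b′ = Equivalence.to
            (does-≡⇒⇔ (_ <? _) (_ <? _)
              (mono (pair b≢b′ eb) (pair c≢c′ ec) (pair⊆g b≢b′ eb) (pair⊆g c≢c′ ec)))
            b<b′

        -- The uniform embedding `f` may differ from `ι`, but both preserve types. Hence the set `S`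
        -- of types of increasing pairs, read off along `f`, defines the same order on the image of
        -- `ι`.
        definable-order-on : Injective _≡_ _≡_ ν → {B : Structure L} → 𝒞 B →
          (ι : Embedding B M) →
          ∃[ S ] (∀ x y z → TotalAt (M ⊢_<[ S ]_) (to ι x) (to ι y) (to ι z))
        definable-order-on ν-inj {B} B∈ ι = S , λ x y z →
          totalAt-map {_≈_ = M ⊢_<[ S ]_} (injective ι) <⇔<[S]
            (<-on-totalAt (injective f ∘ ν-inj) x y z)
          where
          F = uniform-embedding (vectors booleans #atoms) B∈
          f = proj₁ F

          Increasing : Vec Bool #atoms → Set
          Increasing t = ∃[ b ] ∃[ b′ ]
            (b ≢ b′ × pairType B b b′ ≡ t × ν (to f b) < ν (to f b′))

          increasing : Vec Bool #atoms → Bool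
          increasing t = does (em {Increasing t})

          S : Tree #atoms
          S = tabulate increasing

          eval-S : ∀ b b′ → eval S (pairType M (to ι b) (to ι b′)) ≡
                            increasing (pairType B b b′)
          eval-S b b′ = trans (eval-tabulate increasing _)
            (cong increasing (sym (pairType-embedding ι b b′)))

          <⇔<[S] : ∀ b b′ → (ν (to f b) < ν (to f b′)) ⇔ (M ⊢ to ι b <[ S ] to ι b′)
          <⇔<[S] b b′ = mk⇔
            (λ b<b′ → let b≢b′ = λ { refl → <-irrefl refl b<b′ } in
              b≢b′ ∘ injective ι ,
              Equivalence.to (decide-correct M _ atoms S)
                (trans (eval-S b b′) (dec-true em (b , b′ , b≢b′ , refl , b<b′))))
            -- Membership of the type in `S` yields only some increasing pair `c`, `c′`; uniformity
            -- carries this over to `b`, `b′`.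
            λ { (b≢b′ , sat) →
              let c , c′ , c≢c′ , eq , c<c′ = does-true em
                    (trans (sym (eval-S b b′))
                           (Equivalence.from (decide-correct M _ atoms S) sat))
              in proj₂ F (∈-vectors ∈-booleans _) c≢c′ (b≢b′ ∘ cong (to ι)) eq refl c<c′ }

        -- A compactness argument over the finitely many trees. If each `S` failed at some triple,
        -- the finite substructure on all these triples would still be ordered by some `S`, which
        -- fails at its own triple.
        definable-order : Injective _≡_ _≡_ ν →
          ∃[ S ] (∀ x y z → TotalAt (M ⊢_<[ S ]_) x y z)
        definable-order ν-inj = decidable-stable em λ ¬order →
          let
            failure : ∀ S → ∃[ x ] ∃[ y ] ∃[ z ] ¬ TotalAt (M ⊢_<[ S ]_) x y z
            failure S = decidable-stable em λ ¬failure →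
              ¬order (S , λ x y z → decidable-stable em λ ¬total →
                ¬failure (x , y , z , ¬total))
            failing = λ S → let x , y , z , _ = failure S in x ∷ y ∷ z ∷ []
            -- `inhabited M` heads the list to supply the point of the substructure.
            open FiniteCover
              (finiteCover em (inhabited M ∷ concatMap failing (trees #atoms)))
            cover : ∀ {S w} → w ∈ failing S → ∃[ i ] points i ≡ w
            cover {S} w∈ = covers (there (∈-concatMap⁺ failing (lose (∈-trees S) w∈)))
            S , total = definable-order-on ν-inj
              (substructure∈ points {proj₁ (covers (here refl))} distinct)
              (pullback-embedding distinct)
            x , y , z , ¬total = failure S
            i , i≡x = cover {S} (here refl)
            j , j≡y = cover {S} (there (here refl))
            l , l≡z = cover {S} (there (there (here refl)))
          in ¬total (subst₃ (TotalAt (M ⊢_<[ S ]_)) i≡x j≡y l≡z (total i j l))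

theorem1p5 : ∀ {ℓ : Level} → ExcludedMiddle (lsuc 0ℓ ⊔ ℓ) →
    (L : Language) (𝒞 : Class {L} ℓ) (M : Structure L) →
    IsFraïsséClass 𝒞 → IsFraïsséLimit 𝒞 M →
    (∀ A → 𝒞 A → Rigid A) →
    HasTotalOrderReduct M
    ⊎ (∃[ A ] ∃[ B ] (𝒞 A × 𝒞 B × HasSize A 2 × WitnessNotRamsey 𝒞 A B))
theorem1p5 {ℓ} em L 𝒞 M _ limit _
  with em {∃[ A ] ∃[ B ] (𝒞 A × 𝒞 B × HasSize A 2 × WitnessNotRamsey 𝒞 A B)}
... | yes witness = inj₂ witness
... | no ¬witness = inj₁
  ( M ⊢_<[ proj₁ order ]_
  , totalAt⇒isStrictTotalOrder (proj₂ order)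
  , orderFormula (proj₁ order)
  , λ x y → ⇔-id _ )
  where
  open IsFraïsséLimit limit

  em₀ : ExcludedMiddle 0ℓ
  em₀ = map′ lower lift (em {Lift (lsuc 0ℓ ⊔ ℓ) _})

  -- If no `C` served all colourings, every `C` would have a colouring without monochromatic copy of
  -- `B`, and (b) would hold.
  ramsey : ∀ {A B} → 𝒞 A → 𝒞 B → HasSize A 2 → RamseyFor 𝒞 A B
  ramsey {A} {B} A∈ B∈ |A|≡2 = decidable-stable em λ ¬ramsey →
    ¬witness (A , B , A∈ , B∈ , |A|≡2 , λ {C} C∈ →
      decidable-stable em₀ λ ¬colouring →
        ¬ramsey (C , C∈ , λ χ → decidable-stable em₀ λ ¬mono →
          ¬colouring (χ , λ g mono → ¬mono (g , mono))))

  order = definable-order em₀ age (Injection.to countable) ramsey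
                          (Injection.injective countable)
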